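{- The class of unlabelled graphs underlying an element of $\mathcal{L}_1^+$ coincides with the class of graphs of treewidth at most two.
   Context: Graphs are undirected, finite, and without multiple edges; they may have loops. Classes of unlabelled graphs are considered up to isomorphism. A tree decomposition of a graph $F$ is a map $\beta\colon V(T)\to 2^{V(F)}$, where $T$ is a tree, such that $\bigcup_{t\in V(T)}\beta(t)=V(F)$, for every $e\in E(F)$ there is $t\in V(T)$ with $e\subseteq\beta(t)$, and for every $v\in V(F)$ the set of $t\in V(T)$ with $v\in\beta(t)$ induces a connected subgraph of $T$. Its width is $\max_{t\in V(T)}|\beta(t)|-1$. The treewidth of $F$ is the minimal width of a tree decomposition of $F$. A $(1,1)$-bilabelled graph is a tuple $\boldsymbol{F}=(F,u,v)$ with $F$ a graph and $u,v\in V(F)$ (in-label $u$, out-label $v$; $u=v$ is allowed). $F$ is its underlying unlabelled graph. The series composition $\boldsymbol{F}\cdot\boldsymbol{F}'$ of $\boldsymbol{F}=(F,u,v)$ and $\boldsymbol{F}'=(F',u',v')$ is obtained from the disjoint union of $F$ and $F'$ by identifying $v$ with $u'$, with in-label $u$ and out-label $v'$. The parallel composition $\boldsymbol{F}\odot\boldsymbol{F}'$ is obtained from the disjoint union of $F$ and $F'$ by identifying $u$ with $u'$ and $v$ with $v'$, with in-label $u$ and out-label $v$. In both cases, multiple edges arising are removed and loops are kept. The symmetric group $\mathfrak{S}_2$ acts on $(1,1)$-bilabelled graphs by permuting labels, i.e. the non-trivial element sends $(F,u,v)$ to $(F,v,u)$. A $(1,1)$-bilabelled graph is atomic if all its vertices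 are labelled; $\mathcal{A}_1$ is the set of atomic $(1,1)$-bilabelled graphs. $\mathcal{L}_1^+$ is the class of $(1,1)$-bilabelled graphs generated by $\mathcal{A}_1$ under (arbitrary) parallel composition, series composition, and the action of $\mathfrak{S}_2$ on the labels. -}

module Defs where

open import Data.Fin.Base using (Fin)
open import Data.Fin.Subset using (Subset; ∣_∣) renaming (_∈_ to _∈ˢ_)
open import Data.List.Base using (List; _∷_; []; _++_; length; map; allFin)
open import Data.List.Extrema.Nat using (max)
open import Data.List.Relation.Unary.Linked using (Linked)
open import Data.List.Relation.Unary.Unique.Propositional using (Unique)
open import Data.Nat.Base using (ℕ; NonZero; _≤_; _∸_)
open import Data.Nat.Properties using (≤-trans; ≤-reflexive)
open import Data.Product.Base using (Σ; Σ-syntax; ∃; ∃₂; ∃-syntax; _×_; _,_)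
open import Data.Sum.Base using (_⊎_; inj₁; inj₂)
open import Data.Sum.Relation.Binary.Pointwise using (Pointwise)
open import Function.Bundles using (_↔_; _⇔_; mk⇔; Inverse)
open import Function.Definitions using (Surjective)
open import Level using (0ℓ)
open import Relation.Binary.Core using (Rel; REL)
open import Relation.Binary.Definitions using (Symmetric; Irreflexive; Decidable)
open import Relation.Binary.Construct.Closure.Equivalence using (EqClosure)
open import Relation.Binary.Construct.Closure.ReflexiveTransitive using (Star)
open import Relation.Binary.PropositionalEquality.Core using (_≡_)
open import Relation.Nullary.Negation.Core using (¬_)

-- Loops are allowed. A graph has at least one vertex: the empty graph carries
-- no labels, so it underlies no bilabelled graph although it has treewidth -1.
record Graph : Set₁ where
  field
    order    : ℕ
    nonempty : NonZero order

  Vertex : Set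
  Vertex = Fin order

  field
    Adj  : Rel Vertex 0ℓ
    sym  : Symmetric Adj
    adj? : Decidable Adj

open Graph public using (Vertex; Adj)

record _≅_ (F G : Graph) : Set where
  field
    bijection : Vertex F ↔ Vertex G
    adjacency : ∀ x y →
      Adj F x y ⇔ Adj G (Inverse.to bijection x) (Inverse.to bijection y)

-- A cycle is given by its pairwise distinct vertices in cyclic order, without
-- repeating the first vertex at the end.
record Cycle (G : Graph) : Set where
  field
    start    : Vertex G
    rest     : List (Vertex G)
    long     : 3 ≤ length (start ∷ rest)
    distinct : Unique (start ∷ rest)
    closed   : Linked (Adj G) (start ∷ rest ++ start ∷ [])

-- The subgraph induced by P is connected, where the empty subgraph is allowed.
InducedConnected : (G : Graph) → (Vertex G → Set) → Set
InducedConnected G P =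
  ∀ {x y} → P x → P y → Star (λ a b → P a × P b × Adj G a b) x y

record IsTree (T : Graph) : Set where
  field
    loopless  : Irreflexive _≡_ (Adj T)
    connected : ∀ x y → Star (Adj T) x y
    acyclic   : ¬ Cycle T

record TreeDecomposition (F : Graph) : Set₁ where
  field
    tree         : Graph
    isTree       : IsTree tree
    bag          : Vertex tree → Subset (Graph.order F)
    coversVertex : ∀ v → ∃[ t ] v ∈ˢ bag t
    coversEdge   : ∀ u v → Adj F u v → ∃[ t ] (u ∈ˢ bag t × v ∈ˢ bag t)
    connected    : ∀ v → InducedConnected tree (λ t → v ∈ˢ bag t)

  -- Some bag is nonempty because F is, so neither the base value of max nor
  -- the truncation of the subtraction affects the result.
  width : ℕ
  width = max 0 (map (λ t → ∣ bag t ∣) (allFin (Graph.order tree))) ∸ 1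

open TreeDecomposition public using (width)

IsTreewidth : Graph → ℕ → Set₁
IsTreewidth F w =
  (Σ[ D ∈ TreeDecomposition F ] width D ≡ w) ×
  ((D : TreeDecomposition F) → w ≤ width D)

-- The minimal width is at most k. Stated without naming the minimum, whose
-- value need not be available constructively; see IsTreewidth⇒≤⇔.
TreewidthAtMost : ℕ → Graph → Set₁
TreewidthAtMost k F = Σ[ D ∈ TreeDecomposition F ] width D ≤ k

IsTreewidth⇒≤⇔ : ∀ {F w} → IsTreewidth F w → ∀ k → w ≤ k ⇔ TreewidthAtMost k F
IsTreewidth⇒≤⇔ ((D , width≡w) , minimal) k = mk⇔
  (λ w≤k → D , ≤-trans (≤-reflexive width≡w) w≤k)
  (λ (D′ , width≤k) → ≤-trans (minimal D′) width≤k)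

record BilabelledGraph : Set₁ where
  constructor bilabelled
  field
    underlying : Graph
    inLabel    : Vertex underlying
    outLabel   : Vertex underlying

open BilabelledGraph public

swapLabels : BilabelledGraph → BilabelledGraph
swapLabels (bilabelled F u v) = bilabelled F v u

Atomic : BilabelledGraph → Set
Atomic F = ∀ x → x ≡ inLabel F ⊎ x ≡ outLabel F

-- Gluing F G R H: up to isomorphism, H is the disjoint union of F and G with
-- R-related vertices identified, and project is the quotient map. An edge
-- whose endpoints are identified becomes a loop.
record Gluing (F G : Graph) (R : REL (Vertex F) (Vertex G) 0ℓ) (H : Graph) : Set where
  Identify : Rel (Vertex F ⊎ Vertex G) 0ℓ
  Identify p q = ∃₂ λ x y → p ≡ inj₁ x × q ≡ inj₂ y × R x y

  field
    project    : Vertex F ⊎ Vertex G → Vertex H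
    surjective : Surjective _≡_ _≡_ project
    kernel     : ∀ p q → project p ≡ project q ⇔ EqClosure Identify p q
    adjacency  : ∀ a b → Adj H a b ⇔
      (∃₂ λ p q → project p ≡ a × project q ≡ b × Pointwise (Adj F) (Adj G) p q)

record IsSeries (F G H : BilabelledGraph) : Set where
  field
    gluing : Gluing (underlying F) (underlying G)
               (λ x y → x ≡ outLabel F × y ≡ inLabel G)
               (underlying H)
  open Gluing gluing public
  field
    inLabel≡  : inLabel H ≡ project (inj₁ (inLabel F))
    outLabel≡ : outLabel H ≡ project (inj₂ (outLabel G))

record IsParallel (F G H : BilabelledGraph) : Set where
  field
    gluing : Gluing (underlying F) (underlying G)
               (λ x y → (x ≡ inLabel F × y ≡ inLabel G) ⊎
                        (x ≡ outLabel F × y ≡ outLabel G))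
               (underlying H)
  open Gluing gluing public
  field
    inLabel≡  : inLabel H ≡ project (inj₁ (inLabel F))
    outLabel≡ : outLabel H ≡ project (inj₁ (outLabel F))

-- The compositions are relations, so each constructor adds every isomorphic
-- copy of the composite.
data L₁⁺ : BilabelledGraph → Set₁ where
  atomic   : ∀ {F} → Atomic F → L₁⁺ F
  series   : ∀ {F G H} → L₁⁺ F → L₁⁺ G → IsSeries F G H → L₁⁺ H
  parallel : ∀ {F G H} → L₁⁺ F → L₁⁺ G → IsParallel F G H → L₁⁺ H
  swap     : ∀ {F} → L₁⁺ F → L₁⁺ (swapLabels F)

UnderliesL₁⁺ : Graph → Set₁
UnderliesL₁⁺ F = Σ[ B ∈ BilabelledGraph ] (L₁⁺ B × underlying B ≅ F)

{-# OPTIONS --safe #-}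

-- Composition keeps both labels in a common bag: two decompositions with such
-- root bags are joined below a new root bag holding the at most three images of
-- the labels. Conversely, walk through a tree decomposition of width at most two
-- and add the vertices of F one at a time: the at most two earlier vertices of
-- the same bag form a clique, so the new vertex can be attached to an edge, and
-- F becomes, up to loops, a spanning subgraph of a 2-tree K. Let every edge of K
-- carry an element of L₁⁺ labelled by its ends, initially the atomic one. Undoing
-- the last attachment, of w to the edge ab, replaces the graph on ab by its
-- parallel composition with the series composition of those on aw and wb, until
-- a single edge carries all of F.

module Submission where

open import Defs
open import Data.Bool.Base using (Bool; true; false)
import Data.Bool.Properties as Bool
open import Data.Empty using (⊥; ⊥-elim)
open import Data.Fin.Base using (Fin; zero; suc)
open import Data.Fin.Properties using (+↔⊎; 1↔⊤; _≟_; any?)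
open import Data.Fin.Subset
  using (Subset; ∣_∣; ⁅_⁆; _∪_; inside; outside) renaming (_∈_ to _∈ˢ_; ⊥ to ∅)
open import Data.Fin.Subset.Properties
  using (∣⊥∣≡0; ∣⁅x⁆∣≡1; x∈⁅x⁆; x∈⁅y⁆⇒x≡y; x∈p∪q⁺; x∈p∪q⁻; ∉⊥) renaming (_∈?_ to _∈ˢ?_)
open import Data.List.Base using (List; []; _∷_; _++_; allFin; length; filter; lookup; map)
open import Data.List.Extrema.Nat using (max≤v⁺; xs≤max)
open import Data.List.Membership.Propositional using (_∈_; lose)
open import Data.List.Membership.Propositional.Properties
  using (∈-filter⁺; ∈-filter⁻; ∈-lookup; ∈-allFin; ∈-map⁺; ∈-map⁻)
open import Data.List.Properties using (filter-notAll; length-map)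
open import Data.List.Relation.Unary.All as All using (All; []; _∷_)
import Data.List.Relation.Unary.All.Properties as All
open import Data.List.Relation.Unary.AllPairs using ([]; _∷_)
open import Data.List.Relation.Unary.Any as Any using (here; there)
open import Data.List.Relation.Unary.Any.Properties using (lookup-index)
open import Data.List.Relation.Unary.Linked using (Linked; [-]; _∷_)
open import Data.List.Relation.Unary.Unique.Propositional using (Unique)
open import Data.List.Relation.Unary.Unique.Propositional.Properties using (filter⁺; allFin⁺)
open import Data.Maybe.Base using (Maybe; just; nothing; maybe)
open import Data.Maybe.Properties as Maybe using (just-injective)
open import Data.Nat.Base using (ℕ; suc; NonZero; _+_; _≤_; _<_; z≤n; s≤s; s≤s⁻¹)
open import Data.Nat.Properties
  using (≤-trans; ≤-reflexive; +-mono-≤; +-suc; m≤n⇒m≤1+n; <-trans; <-irrefl; ∸-monoˡ-≤; m≤n+m∸n)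
open import Data.Product.Base using (Σ-syntax; ∃; ∃₂; ∃-syntax; _×_; _,_; proj₁; proj₂)
open import Data.Sum.Base as Sum using (_⊎_; inj₁; inj₂; [_,_])
open import Data.Sum.Function.Propositional using (_⊎-↔_)
import Data.Sum.Properties as Sumₚ
open import Data.Sum.Relation.Binary.Pointwise using (inj₁; inj₂; Pointwise)
open import Data.Unit.Base using (⊤; tt)
open import Data.Vec.Base using ([]; _∷_; here; there)
open import Function.Base using (_∘_; id)
open import Function.Bundles using (_↔_; Inverse; Equivalence; _⇔_; mk⇔; mk↔ₛ′)
open import Function.Construct.Composition using (_↔-∘_)
open import Function.Construct.Identity using (↔-id; ⇔-id)
open import Level using (0ℓ)
open import Relation.Binary.Construct.Closure.Equivalence using (EqClosure)
open import Relation.Binary.Construct.Closure.ReflexiveTransitive as Star using (Star; ε; _◅_; _◅◅_)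
open import Relation.Binary.Construct.Closure.Symmetric as SymClosure using (SymClosure; fwd; bwd)
open import Relation.Binary.Core using (Rel; REL)
open import Relation.Binary.Definitions using (Symmetric; DecidableEquality)
open import Relation.Binary.PropositionalEquality
  using (_≡_; _≢_; refl; sym; trans; cong; subst; subst₂; ≢-sym)
open import Relation.Nullary.Decidable.Core using (Dec; yes; no; map′; _⊎-dec_)
open import Relation.Nullary.Negation.Core using (¬_; contradiction)
open import Relation.Unary using (Pred; Decidable)

-- Acyclicity of rooted trees

-- A walk that never turns back goes up for a while and then down for good. A
-- closed one would have to enter and leave its start through the same parent.
module _ (G : Graph) (Up : Rel (Vertex G) 0ℓ) (depth : Vertex G → ℕ)
  (up-functional : ∀ {x y z} → Up x y → Up x z → y ≡ z)
  (up-depth : ∀ {x y} → Up x y → depth y < depth x)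
  (adj-up : ∀ {x y} → Adj G x y → Up x y ⊎ Up y x) where

  private
    -- the last vertex before the end e of the walk y ∷ zs ++ e ∷ []
    penultimate : Vertex G → List (Vertex G) → Vertex G
    penultimate y []       = y
    penultimate _ (z ∷ zs) = penultimate z zs

    NonBacktracking : List (Vertex G) → Set
    NonBacktracking (x ∷ y ∷ z ∷ zs) = x ≢ z × NonBacktracking (y ∷ z ∷ zs)
    NonBacktracking _                = ⊤

    -- An upward step right after a downward one would return to the vertex just left, because
    -- parents are unique. So every later step goes down, and `e` is entered from its parent.
    descend : ∀ {x y} zs {e} → Up y x → Linked (Adj G) (y ∷ zs ++ e ∷ []) →
              NonBacktracking (x ∷ y ∷ zs ++ e ∷ []) →
              depth x < depth e × Up e (penultimate y zs)
    descend [] up (adj ∷ [-]) (x≢e , _) with adj-up adj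
    ... | inj₁ up′ = ⊥-elim (x≢e (up-functional up up′))
    ... | inj₂ up′ = <-trans (up-depth up) (up-depth up′) , up′
    descend (z ∷ zs) up (adj ∷ adjs) (x≢z , nb) with adj-up adj
    ... | inj₁ up′ = ⊥-elim (x≢z (up-functional up up′))
    ... | inj₂ up′ with descend zs up′ adjs nb
    ... | y<e , up″ = <-trans (up-depth up) y<e , up″

    -- Either every step goes up, and `e` is shallower than the start, or the walk turns down at
    -- some point and `descend` takes over.
    traverse : ∀ {x y} zs {e} → Linked (Adj G) (x ∷ y ∷ zs ++ e ∷ []) →
               NonBacktracking (x ∷ y ∷ zs ++ e ∷ []) →
               depth e < depth x ⊎ Up e (penultimate y zs)
    traverse zs (adj ∷ adjs) nb with adj-up adj
    traverse zs (adj ∷ adjs) nb | inj₂ up = inj₂ (proj₂ (descend zs up adjs nb))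
    traverse [] (_ ∷ adj ∷ [-]) nb | inj₁ up with adj-up adj
    ... | inj₁ up′ = inj₁ (<-trans (up-depth up′) (up-depth up))
    ... | inj₂ up′ = inj₂ up′
    traverse (z ∷ zs) (_ ∷ adjs) (_ , nb) | inj₁ up with traverse zs adjs nb
    ... | inj₁ e<y = inj₁ (<-trans e<y (up-depth up))
    ... | inj₂ up′ = inj₂ up′

    -- The only new triple ends in `e`. Its first vertex differs from `e` unless it is the start
    -- `x`, for which nothing is assumed because a closed walk has `e` equal to `x`.
    nonBacktracking : ∀ {x y} zs {e} → All (_≢ e) (y ∷ zs) → Unique (x ∷ y ∷ zs) →
                      NonBacktracking (x ∷ y ∷ zs) → zs ≡ [] ⊎ NonBacktracking (x ∷ y ∷ zs ++ e ∷ [])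
    nonBacktracking [] _ _ _ = inj₁ refl
    nonBacktracking (z ∷ zs) (y≢e ∷ ≢e) (_ ∷ u) (x≢z , nb) with nonBacktracking zs ≢e u nb
    ... | inj₁ refl = inj₂ (x≢z , y≢e , tt)
    ... | inj₂ nb′ = inj₂ (x≢z , nb′)

    unique⇒nonBacktracking : ∀ {xs} → Unique xs → NonBacktracking xs
    unique⇒nonBacktracking {[]} _ = tt
    unique⇒nonBacktracking {_ ∷ []} _ = tt
    unique⇒nonBacktracking {_ ∷ _ ∷ []} _ = tt
    unique⇒nonBacktracking {_ ∷ _ ∷ _ ∷ _} ((_ ∷ x≢z ∷ _) ∷ u) = x≢z , unique⇒nonBacktracking u

    penultimate∈ : ∀ {P : Vertex G → Set} {y} zs → All P (y ∷ zs) → P (penultimate y zs)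
    penultimate∈ []       (p ∷ _)  = p
    penultimate∈ (_ ∷ zs) (_ ∷ ps) = penultimate∈ zs ps

  acyclic : ¬ Cycle G
  acyclic record { rest = [] ; long = s≤s () }
  acyclic record { rest = _ ∷ [] ; long = s≤s (s≤s ()) }
  acyclic record { start = x ; rest = y ∷ z ∷ zs ; distinct = u@(≢x ∷ y≢ ∷ _) ; closed = adj ∷ adjs }
    with nonBacktracking (z ∷ zs) (All.map ≢-sym ≢x) u (unique⇒nonBacktracking u)
  ... | inj₂ nb with traverse (z ∷ zs) (adj ∷ adjs) nb
  ... | inj₁ x<x = <-irrefl refl x<x
  ... | inj₂ up with adj-up adj
  ... | inj₁ up′ = penultimate∈ {y = z} zs y≢ (up-functional up′ up)
  ... | inj₂ up′ = <-irrefl refl (proj₁ (descend (z ∷ zs) up′ adjs nb))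

-- Rooted binary trees

-- Full binary trees suffice: an atomic graph needs one bag, and each composition puts a new root
-- above two trees.
data Shape : Set where
  leaf : Shape
  node : Shape → Shape → Shape

Node : Shape → Set
Node leaf       = ⊤
Node (node l r) = ⊤ ⊎ (Node l ⊎ Node r)

pattern top     = inj₁ tt
pattern left x  = inj₂ (inj₁ x)
pattern right x = inj₂ (inj₂ x)

root : ∀ s → Node s
root leaf       = tt
root (node _ _) = top

parent : ∀ s → Node s → Maybe (Node s)
parent leaf       _         = nothing
parent (node _ _) top       = nothing
parent (node l _) (left x)  = just (maybe (λ y → left y) top (parent l x))
parent (node _ r) (right x) = just (maybe (λ y → right y) top (parent r x))

depth : ∀ s → Node s → ℕ
depth leaf       _         = 0
depth (node _ _) top       = 0
depth (node l _) (left x)  = suc (depth l x)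
depth (node _ r) (right x) = suc (depth r x)

parent-depth : ∀ s {x y} → parent s x ≡ just y → depth s y < depth s x
parent-depth (node l _) {left x} eq with parent l x in eqₗ
parent-depth (node l _) {left x} refl | nothing = s≤s z≤n
parent-depth (node l _) {left x} refl | just _  = s≤s (parent-depth l eqₗ)
parent-depth (node _ r) {right x} eq with parent r x in eqᵣ
parent-depth (node _ r) {right x} refl | nothing = s≤s z≤n
parent-depth (node _ r) {right x} refl | just _  = s≤s (parent-depth r eqᵣ)

Linkedᵗ : ∀ s → Rel (Node s) 0ℓ
Linkedᵗ s = SymClosure (λ x y → parent s x ≡ just y)

module _ {l r : Shape} where

  left-linked : ∀ {x y} → Linkedᵗ l x y → Linkedᵗ (node l r) (left x) (left y)
  left-linked = SymClosure.gmap (λ x → left x) (cong (λ m → just (maybe (λ y → left y) top m)))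

  right-linked : ∀ {x y} → Linkedᵗ r x y → Linkedᵗ (node l r) (right x) (right y)
  right-linked = SymClosure.gmap (λ x → right x) (cong (λ m → just (maybe (λ y → right y) top m)))

parent-root : ∀ s → parent s (root s) ≡ nothing
parent-root leaf       = refl
parent-root (node _ _) = refl

root-left : ∀ l r → Linkedᵗ (node l r) (left (root l)) top
root-left l r = fwd (cong (λ m → just (maybe (λ y → left y) top m)) (parent-root l))

root-right : ∀ l r → Linkedᵗ (node l r) (right (root r)) top
root-right l r = fwd (cong (λ m → just (maybe (λ y → right y) top m)) (parent-root r))

to-root : ∀ s x → Star (Linkedᵗ s) x (root s)
to-root leaf       _         = ε
to-root (node l r) top       = ε
to-root (node l r) (left x)  =
  Star.gmap (λ x → left x) left-linked (to-root l x) ◅◅ root-left l r ◅ ε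
to-root (node l r) (right x) =
  Star.gmap (λ x → right x) right-linked (to-root r x) ◅◅ root-right l r ◅ ε

size : Shape → ℕ
size leaf       = 1
size (node l r) = 1 + (size l + size r)

Fin↔Node : ∀ s → Fin (size s) ↔ Node s
Fin↔Node leaf       = 1↔⊤
Fin↔Node (node l r) =
  (1↔⊤ ⊎-↔ ((Fin↔Node l ⊎-↔ Fin↔Node r) ↔-∘ +↔⊎)) ↔-∘ +↔⊎

_≟ⁿ_ : ∀ {s} → DecidableEquality (Node s)
_≟ⁿ_ {leaf}     tt tt = yes refl
_≟ⁿ_ {node l r} = Sumₚ.≡-dec (λ _ _ → yes refl) (Sumₚ.≡-dec _≟ⁿ_ _≟ⁿ_)

inhabited⇒nonZero : ∀ {n} → Fin n → NonZero n
inhabited⇒nonZero zero    = _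
inhabited⇒nonZero (suc _) = _

module ShapeGraph (s : Shape) where

  open Inverse (Fin↔Node s) public using () renaming (to to decode; from to encode)

  decode-encode : ∀ x → decode (encode x) ≡ x
  decode-encode x = Inverse.inverseˡ (Fin↔Node s) refl

  encode-decode : ∀ i → encode (decode i) ≡ i
  encode-decode i = Inverse.inverseʳ (Fin↔Node s) refl

  linked? : ∀ x y → Dec (Linkedᵗ s x y)
  linked? x y = map′ [ fwd , bwd ] (λ { (fwd p) → inj₁ p ; (bwd p) → inj₂ p })
    (Maybe.≡-dec _≟ⁿ_ _ _ ⊎-dec Maybe.≡-dec _≟ⁿ_ _ _)

  graph : Graph
  graph = record
    { order    = size s
    ; nonempty = inhabited⇒nonZero (encode (root s))
    ; Adj      = λ i j → Linkedᵗ s (decode i) (decode j)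
    ; sym      = SymClosure.symmetric _
    ; adj?     = λ i j → linked? (decode i) (decode j)
    }

  encode-linked : ∀ {x y} → Linkedᵗ s x y → Adj graph (encode x) (encode y)
  encode-linked {x} {y} rewrite decode-encode x | decode-encode y = id

  isTree : IsTree graph
  isTree = record
    { loopless  = λ { refl (fwd up) → <-irrefl refl (parent-depth s up)
                    ; refl (bwd up) → <-irrefl refl (parent-depth s up) }
    ; connected = λ i j → reach i ◅◅ Star.reverse (SymClosure.symmetric _) (reach j)
    ; acyclic   = acyclic graph (λ i j → parent s (decode i) ≡ just (decode j))
        (depth s ∘ decode)
        (λ {x} {y} {z} p q → trans (sym (encode-decode y))
          (trans (cong encode (just-injective (trans (sym p) q))) (encode-decode z)))
        (parent-depth s)
        (λ { (fwd p) → inj₁ p ; (bwd p) → inj₂ p })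
    }
    where
    reach : ∀ i → Star (Adj graph) i (encode (root s))
    reach i = subst (λ k → Star (Adj graph) k (encode (root s))) (encode-decode i)
      (Star.gmap encode encode-linked (to-root s (decode i)))

-- Decompositions with bags of at most three vertices

-- A bag is a family of `k` vertices with repetitions allowed, so the bound on its size is part of
-- its type.
_∈ᵇ_ : ∀ {k} {V : Set} → V → (Fin k → V) → Set
v ∈ᵇ b = ∃[ i ] b i ≡ v

Joins : ∀ s {V : Set} → (Node s → Fin 3 → V) → V → Rel (Node s) 0ℓ
Joins s bag v x y = v ∈ᵇ bag x × v ∈ᵇ bag y × Linkedᵗ s x y

Joins-sym : ∀ s {V : Set} {bag : Node s → Fin 3 → V} {v} → Symmetric (Joins s bag v)
Joins-sym s (v∈x , v∈y , xy) = v∈y , v∈x , SymClosure.symmetric _ xy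

record Decomposition (F : Graph) : Set where
  field
    shape        : Shape
    bag          : Node shape → Fin 3 → Vertex F
    coversVertex : ∀ v → ∃[ x ] v ∈ᵇ bag x
    coversEdge   : ∀ {u v} → Adj F u v → ∃[ x ] (u ∈ᵇ bag x × v ∈ᵇ bag x)
    connected    : ∀ {v x y} → v ∈ᵇ bag x → v ∈ᵇ bag y → Star (Joins shape bag v) x y

  rootBag : Fin 3 → Vertex F
  rootBag = bag (root shape)

∣p∪q∣≤∣p∣+∣q∣ : ∀ {n} (p q : Subset n) → ∣ p ∪ q ∣ ≤ ∣ p ∣ + ∣ q ∣
∣p∪q∣≤∣p∣+∣q∣ []          []          = z≤n
∣p∪q∣≤∣p∣+∣q∣ (inside  ∷ p) (inside  ∷ q) =
  s≤s (≤-trans (m≤n⇒m≤1+n (∣p∪q∣≤∣p∣+∣q∣ p q)) (≤-reflexive (sym (+-suc _ _))))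
∣p∪q∣≤∣p∣+∣q∣ (inside  ∷ p) (outside ∷ q) = s≤s (∣p∪q∣≤∣p∣+∣q∣ p q)
∣p∪q∣≤∣p∣+∣q∣ (outside ∷ p) (inside  ∷ q) =
  ≤-trans (s≤s (∣p∪q∣≤∣p∣+∣q∣ p q)) (≤-reflexive (sym (+-suc _ _)))
∣p∪q∣≤∣p∣+∣q∣ (outside ∷ p) (outside ∷ q) = ∣p∪q∣≤∣p∣+∣q∣ p q

range : ∀ {k n} → (Fin k → Fin n) → Subset n
range {0}     b = ∅
range {suc k} b = ⁅ b zero ⁆ ∪ range (b ∘ suc)

∣range∣≤ : ∀ {k n} (b : Fin k → Fin n) → ∣ range b ∣ ≤ k
∣range∣≤ {0} {n} b = ≤-reflexive (∣⊥∣≡0 n)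
∣range∣≤ {suc k} b = ≤-trans (∣p∪q∣≤∣p∣+∣q∣ ⁅ b zero ⁆ _)
  (+-mono-≤ (≤-reflexive (∣⁅x⁆∣≡1 (b zero))) (∣range∣≤ (b ∘ suc)))

∈-range⁺ : ∀ {k n} (b : Fin k → Fin n) {v} → v ∈ᵇ b → v ∈ˢ range b
∈-range⁺ b (zero  , refl) = x∈p∪q⁺ (inj₁ (x∈⁅x⁆ _))
∈-range⁺ b (suc i , refl) = x∈p∪q⁺ (inj₂ (∈-range⁺ (b ∘ suc) (i , refl)))

∈-range⁻ : ∀ {k n} (b : Fin k → Fin n) {v} → v ∈ˢ range b → v ∈ᵇ b
∈-range⁻ {0}     b v∈ = ⊥-elim (∉⊥ v∈)
∈-range⁻ {suc k} b v∈ with x∈p∪q⁻ ⁅ b zero ⁆ _ v∈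
... | inj₁ v∈₁ = zero , sym (x∈⁅y⁆⇒x≡y _ v∈₁)
... | inj₂ v∈₂ = let i , eq = ∈-range⁻ (b ∘ suc) v∈₂ in suc i , eq

Decomposition⇒TreewidthAtMost2 : ∀ {F} → Decomposition F → TreewidthAtMost 2 F
Decomposition⇒TreewidthAtMost2 {F} D =
  record
    { tree         = graph
    ; isTree       = isTree
    ; bag          = λ i → range (bag (decode i))
    ; coversVertex = λ v → let x , v∈ = coversVertex v in encode x , ∈-encode v∈
    ; coversEdge   = λ _ _ uv → let x , u∈ , v∈ = coversEdge uv in encode x , ∈-encode u∈ , ∈-encode v∈
    ; connected    = λ v {i} {j} v∈i v∈j →
        subst₂ (Star (λ a b → v ∈ˢ range (bag (decode a)) × v ∈ˢ range (bag (decode b)) × Adj graph a b))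
          (encode-decode i) (encode-decode j)
          (Star.gmap encode (λ (v∈x , v∈y , xy) → ∈-encode v∈x , ∈-encode v∈y , encode-linked xy)
            (connected (∈-range⁻ _ v∈i) (∈-range⁻ _ v∈j)))
    }
  -- The base value 0 and all bag sizes are at most 3, so the width is at most 3 ∸ 1 = 2.
  , ∸-monoˡ-≤ 1 (max≤v⁺ z≤n (All.map⁺ (All.universal (λ i → ∣range∣≤ (bag (decode i))) (allFin (Graph.order graph)))))
  where
  open Decomposition D
  open ShapeGraph shape
  ∈-encode : ∀ {v x} → v ∈ᵇ bag x → v ∈ˢ range (bag (decode (encode x)))
  ∈-encode {v} {x} v∈ = ∈-range⁺ _ (subst (λ y → v ∈ᵇ bag y) (sym (decode-encode x)) v∈)

-- Decompositions along isomorphisms and gluings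

Decomposition-≅ : ∀ {F G} → F ≅ G → Decomposition F → Decomposition G
Decomposition-≅ {F} {G} F≅G D = record
  { shape        = shape
  ; bag          = λ x → to ∘ bag x
  ; coversVertex = λ v → let x , i , eq = coversVertex (from v) in x , i , inverseˡ eq
  ; coversEdge   = λ {u} {v} uv →
      let x , (i , eqᵤ) , (j , eqᵥ) = coversEdge (Equivalence.from (adjacency (from u) (from v))
            (subst₂ (Adj G) (sym (inverseˡ refl)) (sym (inverseˡ refl)) uv))
      in x , (i , inverseˡ eqᵤ) , (j , inverseˡ eqᵥ)
  ; connected    = λ { (i , refl) (j , eq) →
      Star.map (λ ((i , p) , (j , q) , xy) → (i , cong to p) , (j , cong to q) , xy)
        (connected (i , refl) (j , to-injective eq)) }
  }
  where
  open _≅_ F≅G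
  open Inverse bijection
  open Decomposition D
  to-injective : ∀ {u v} → to u ≡ to v → u ≡ v
  to-injective eq = trans (sym (inverseʳ refl)) (inverseʳ eq)

module _ {F G H : Graph} {R : REL (Vertex F) (Vertex G) 0ℓ} (glue : Gluing F G R H)
  (D : Decomposition F) (E : Decomposition G) where

  private
    open Gluing glue
    module D = Decomposition D
    module E = Decomposition E

  module _ (Label : Vertex F ⊎ Vertex G → Set)
    (R-label : ∀ {x y} → R x y → Label (inj₁ x) × Label (inj₂ y))
    (Label-F : ∀ {x} → Label (inj₁ x) → x ∈ᵇ D.rootBag)
    (Label-G : ∀ {y} → Label (inj₂ y) → y ∈ᵇ E.rootBag)
    (S : Fin 3 → Vertex H)
    (S-label : ∀ i → ∃[ p ] (Label p × project p ≡ S i))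
    (label-S : ∀ {p} → Label p → project p ∈ᵇ S) where

    private
      step-label : ∀ {p q} → SymClosure Identify p q → Label p × Label q
      step-label (fwd (_ , _ , refl , refl , r)) = R-label r
      step-label (bwd (_ , _ , refl , refl , r)) = let a , b = R-label r in b , a

      -- Every single identification involves two labels, so a nontrivial chain of them starts and
      -- ends in labels.
      closure-label : ∀ {p q} → EqClosure Identify p q → p ≡ q ⊎ (Label p × Label q)
      closure-label ε = inj₁ refl
      closure-label (st ◅ sts) with closure-label sts
      ... | inj₁ refl    = inj₂ (step-label st)
      ... | inj₂ (_ , q) = inj₂ (proj₁ (step-label st) , q)

      shape : Shape
      shape = node D.shape E.shape

      bag : Node shape → Fin 3 → Vertex H
      bag top       = S
      bag (left x)  = project ∘ inj₁ ∘ D.bag x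
      bag (right x) = project ∘ inj₂ ∘ E.bag x

      -- Membership is tracked before the identification, so that different preimages of a vertex
      -- can be treated separately.
      Holds : Node shape → Vertex F ⊎ Vertex G → Set
      Holds top       p        = Label p
      Holds (left x)  (inj₁ v) = v ∈ᵇ D.bag x
      Holds (left _)  (inj₂ _) = ⊥
      Holds (right _) (inj₁ _) = ⊥
      Holds (right x) (inj₂ v) = v ∈ᵇ E.bag x

      holds⇒∈ : ∀ x p → Holds x p → project p ∈ᵇ bag x
      holds⇒∈ top       _        l          = label-S l
      holds⇒∈ (left x)  (inj₁ _) (i , refl) = i , refl
      holds⇒∈ (right x) (inj₂ _) (i , refl) = i , refl

      ∈⇒holds : ∀ x {w} → w ∈ᵇ bag x → ∃[ p ] (Holds x p × project p ≡ w)
      ∈⇒holds top       (i , refl) = S-label i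
      ∈⇒holds (left x)  (i , eq)   = _ , (i , refl) , eq
      ∈⇒holds (right x) (i , eq)   = _ , (i , refl) , eq

      map-left : ∀ {v x y} → Star (Joins D.shape D.bag v) x y →
                 Star (Joins shape bag (project (inj₁ v))) (left x) (left y)
      map-left = Star.gmap (λ x → left x) λ {x} {y} (v∈x , v∈y , xy) →
        holds⇒∈ (left x) _ v∈x , holds⇒∈ (left y) _ v∈y , left-linked xy

      map-right : ∀ {v x y} → Star (Joins E.shape E.bag v) x y →
                  Star (Joins shape bag (project (inj₂ v))) (right x) (right y)
      map-right = Star.gmap (λ x → right x) λ {x} {y} (v∈x , v∈y , xy) →
        holds⇒∈ (right x) _ v∈x , holds⇒∈ (right y) _ v∈y , right-linked xy

      -- A label lies in the root bag of its own side and its image lies in `S`, so a path to that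
      -- root extends to the new one.
      climb : ∀ x p → Holds x p → Label p → Star (Joins shape bag (project p)) x top
      climb top       _        _  _ = ε
      climb (left x)  (inj₁ v) v∈ l = map-left (D.connected v∈ (Label-F l)) ◅◅
        (holds⇒∈ (left (root D.shape)) (inj₁ v) (Label-F l) , label-S l , root-left _ _) ◅ ε
      climb (right x) (inj₂ v) v∈ l = map-right (E.connected v∈ (Label-G l)) ◅◅
        (holds⇒∈ (right (root E.shape)) (inj₂ v) (Label-G l) , label-S l , root-right _ _) ◅ ε

      meet : ∀ x y p → Holds x p → Holds y p → Star (Joins shape bag (project p)) x y
      meet top       y         p        hx hy = Star.reverse (Joins-sym shape) (climb y p hy hx)
      meet (left x)  top       p        hx hy = climb (left x) p hx hy
      meet (right x) top       p        hx hy = climb (right x) p hx hy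
      meet (left x)  (left y)  (inj₁ v) hx hy = map-left (D.connected hx hy)
      meet (right x) (right y) (inj₂ v) hx hy = map-right (E.connected hx hy)
      meet (left _)  (right _) (inj₁ _) _  ()
      meet (left _)  (right _) (inj₂ _) () _
      meet (right _) (left _)  (inj₁ _) () _
      meet (right _) (left _)  (inj₂ _) _  ()

    -- Every edge of `H` comes from one side and is covered there. Connectedness is inherited for a
    -- single preimage; different preimages of one vertex are labels, and their nodes are linked
    -- through the new root with bag `S`.
    gluedDecomposition : Decomposition H
    gluedDecomposition = record
      { shape        = shape
      ; bag          = bag
      ; coversVertex = coversVertex
      ; coversEdge   = coversEdge
      ; connected    = connected
      }
      where
      coversVertex : ∀ v → ∃[ x ] v ∈ᵇ bag x
      coversVertex v with surjective v
      ... | inj₁ a , eq = let x , i , eq′ = D.coversVertex a in left x  , i , eq (cong inj₁ eq′)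
      ... | inj₂ b , eq = let x , i , eq′ = E.coversVertex b in right x , i , eq (cong inj₂ eq′)

      coversEdge : ∀ {u v} → Adj H u v → ∃[ x ] (u ∈ᵇ bag x × v ∈ᵇ bag x)
      coversEdge {u} {v} uv with Equivalence.to (adjacency u v) uv
      ... | _ , _ , refl , refl , inj₁ ab = let x , a∈ , b∈ = D.coversEdge ab in
        left x , holds⇒∈ (left x) _ a∈ , holds⇒∈ (left x) _ b∈
      ... | _ , _ , refl , refl , inj₂ ab = let x , a∈ , b∈ = E.coversEdge ab in
        right x , holds⇒∈ (right x) _ a∈ , holds⇒∈ (right x) _ b∈

      connected : ∀ {w x y} → w ∈ᵇ bag x → w ∈ᵇ bag y → Star (Joins shape bag w) x y
      connected {w} {x} {y} w∈x w∈y with ∈⇒holds x w∈x | ∈⇒holds y w∈y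
      ... | p , hx , refl | q , hy , eq with closure-label (Equivalence.to (kernel q p) eq)
      ... | inj₁ refl = meet x y p hx hy
      ... | inj₂ (lq , lp) = climb x p hx lp ◅◅
        subst (λ w → Star (Joins shape bag w) top y) eq (Star.reverse (Joins-sym shape) (climb y q hy lq))

-- Decompositions with both labels in the root bag

record LabelledDecomposition (B : BilabelledGraph) : Set where
  field
    decomposition : Decomposition (underlying B)
  open Decomposition decomposition public
  field
    inLabel∈  : inLabel B ∈ᵇ rootBag
    outLabel∈ : outLabel B ∈ᵇ rootBag

triple : ∀ {V : Set} → V → V → V → Fin 3 → V
triple a _ _ zero             = a
triple _ b _ (suc zero)       = b
triple _ _ c (suc (suc zero)) = c

IsLabel : ∀ F G → Vertex (underlying F) ⊎ Vertex (underlying G) → Set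
IsLabel F G (inj₁ x) = x ≡ inLabel F ⊎ x ≡ outLabel F
IsLabel F G (inj₂ y) = y ≡ inLabel G ⊎ y ≡ outLabel G

label∈root : ∀ {B} (D : LabelledDecomposition B) {x} → x ≡ inLabel B ⊎ x ≡ outLabel B →
             x ∈ᵇ LabelledDecomposition.rootBag D
label∈root D (inj₁ refl) = LabelledDecomposition.inLabel∈ D
label∈root D (inj₂ refl) = LabelledDecomposition.outLabel∈ D

atomicDecomposition : ∀ {B} → Atomic B → LabelledDecomposition B
atomicDecomposition {B} atom = record
  { decomposition = record
    { shape        = leaf
    ; bag          = λ _ → bag
    ; coversVertex = λ v → tt , covers v
    ; coversEdge   = λ {u} {v} _ → tt , covers u , covers v
    ; connected    = λ _ _ → ε
    }
  ; inLabel∈  = zero , refl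
  ; outLabel∈ = suc zero , refl
  }
  where
  bag = triple (inLabel B) (outLabel B) (outLabel B)
  covers : ∀ v → v ∈ᵇ bag
  covers v with atom v
  ... | inj₁ refl = zero , refl
  ... | inj₂ refl = suc zero , refl

-- The four labels have at most three images, since the out-label of `F` and the in-label of `G`
-- become one vertex. Hence three entries suffice for the new root bag.
seriesDecomposition : ∀ {F G H} → IsSeries F G H → LabelledDecomposition F → LabelledDecomposition G →
                      LabelledDecomposition H
seriesDecomposition {F} {G} {H} ser D E = record
  { decomposition = gluedDecomposition gluing D.decomposition E.decomposition (IsLabel F G)
      (λ (eq , eq′) → inj₂ eq , inj₁ eq′) (label∈root D) (label∈root E) S
      (λ { zero             → inj₁ (inLabel F) , inj₁ refl , refl
         ; (suc zero)       → inj₁ (outLabel F) , inj₂ refl , refl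
         ; (suc (suc zero)) → inj₂ (outLabel G) , inj₂ refl , refl })
      (λ { {inj₁ _} (inj₁ refl) → zero , refl
         ; {inj₁ _} (inj₂ refl) → suc zero , refl
         ; {inj₂ _} (inj₁ refl) → suc zero , middle
         ; {inj₂ _} (inj₂ refl) → suc (suc zero) , refl })
  ; inLabel∈  = zero , sym inLabel≡
  ; outLabel∈ = suc (suc zero) , sym outLabel≡
  }
  where
  open IsSeries ser
  module D = LabelledDecomposition D
  module E = LabelledDecomposition E
  S = triple (project (inj₁ (inLabel F))) (project (inj₁ (outLabel F))) (project (inj₂ (outLabel G)))
  middle : project (inj₁ (outLabel F)) ≡ project (inj₂ (inLabel G))
  middle = Equivalence.from (kernel _ _) (fwd (_ , _ , refl , refl , refl , refl) ◅ ε)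

parallelDecomposition : ∀ {F G H} → IsParallel F G H → LabelledDecomposition F → LabelledDecomposition G →
                        LabelledDecomposition H
parallelDecomposition {F} {G} {H} par D E = record
  { decomposition = gluedDecomposition gluing D.decomposition E.decomposition (IsLabel F G)
      (λ { (inj₁ (eq , eq′)) → inj₁ eq , inj₁ eq′ ; (inj₂ (eq , eq′)) → inj₂ eq , inj₂ eq′ })
      (label∈root D) (label∈root E) S
      (λ { zero             → inj₁ (inLabel F) , inj₁ refl , refl
         ; (suc zero)       → inj₁ (outLabel F) , inj₂ refl , refl
         ; (suc (suc zero)) → inj₁ (outLabel F) , inj₂ refl , refl })
      (λ { {inj₁ _} (inj₁ refl) → zero , refl
         ; {inj₁ _} (inj₂ refl) → suc zero , refl
         ; {inj₂ _} (inj₁ refl) → zero , identified (inj₁ (refl , refl))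
         ; {inj₂ _} (inj₂ refl) → suc zero , identified (inj₂ (refl , refl)) })
  ; inLabel∈  = zero , sym inLabel≡
  ; outLabel∈ = suc zero , sym outLabel≡
  }
  where
  open IsParallel par
  module D = LabelledDecomposition D
  module E = LabelledDecomposition E
  -- The labels have at most two images here; the third entry is a repetition.
  S = triple (project (inj₁ (inLabel F))) (project (inj₁ (outLabel F))) (project (inj₁ (outLabel F)))
  identified : ∀ {x y} → (x ≡ inLabel F × y ≡ inLabel G) ⊎ (x ≡ outLabel F × y ≡ outLabel G) →
               project (inj₁ x) ≡ project (inj₂ y)
  identified r = Equivalence.from (kernel _ _) (fwd (_ , _ , refl , refl , r) ◅ ε)

L₁⁺⇒LabelledDecomposition : ∀ {B} → L₁⁺ B → LabelledDecomposition B
L₁⁺⇒LabelledDecomposition (atomic a)         = atomicDecomposition a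
L₁⁺⇒LabelledDecomposition (series F G ser)   =
  seriesDecomposition ser (L₁⁺⇒LabelledDecomposition F) (L₁⁺⇒LabelledDecomposition G)
L₁⁺⇒LabelledDecomposition (parallel F G par) =
  parallelDecomposition par (L₁⁺⇒LabelledDecomposition F) (L₁⁺⇒LabelledDecomposition G)
L₁⁺⇒LabelledDecomposition (swap F)           = record
  { decomposition = decomposition ; inLabel∈ = outLabel∈ ; outLabel∈ = inLabel∈ }
  where open LabelledDecomposition (L₁⁺⇒LabelledDecomposition F)

UnderliesL₁⁺⇒TreewidthAtMost2 : ∀ {F} → UnderliesL₁⁺ F → TreewidthAtMost 2 F
UnderliesL₁⁺⇒TreewidthAtMost2 (_ , B∈L , B≅F) = Decomposition⇒TreewidthAtMost2
  (Decomposition-≅ B≅F (LabelledDecomposition.decomposition (L₁⁺⇒LabelledDecomposition B∈L)))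

-- Graphs embedded in a fixed vertex set

-- Placing graphs on subsets `P` of a common vertex set turns gluing into union. `E` is constrained
-- only on `P`, and `Within` is its restriction.
record Embedding {n} (G : Graph) (P : Pred (Fin n) 0ℓ) (E : Rel (Fin n) 0ℓ) : Set where
  field
    embed     : Vertex G → Fin n
    injective : ∀ {x y} → embed x ≡ embed y → x ≡ y
    embed∈    : ∀ x → P (embed x)
    preimage  : ∀ {v} → P v → ∃[ x ] embed x ≡ v
    adjacency : ∀ x y → Adj G x y ⇔ E (embed x) (embed y)

  Within : Rel (Fin n) 0ℓ
  Within u v = P u × P v × E u v

  -- `P` is the image of a finite set.
  domain? : Decidable P
  domain? v = map′ (λ { (x , refl) → embed∈ x }) preimage (any? (λ x → embed x ≟ v))

  within? : ∀ u v → Dec (Within u v)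
  within? u v with domain? u | domain? v
  ... | no ¬p | _     = no (λ (p , _) → ¬p p)
  ... | _     | no ¬p = no (λ (_ , p , _) → ¬p p)
  ... | yes p | yes q with preimage p | preimage q
  ... | x , refl | y , refl = map′ (λ a → p , q , Equivalence.to (adjacency x y) a)
    (λ (_ , _ , e) → Equivalence.from (adjacency x y) e) (Graph.adj? G x y)

  within-sym : Symmetric Within
  within-sym (p , q , e) with preimage p | preimage q
  ... | x , refl | y , refl =
    q , p , Equivalence.to (adjacency y x) (Graph.sym G (Equivalence.from (adjacency x y) e))

lookup-injective : ∀ {A : Set} {xs : List A} → Unique xs → ∀ {i j} → lookup xs i ≡ lookup xs j → i ≡ j
lookup-injective (_  ∷ _) {zero}  {zero}  _  = refl
lookup-injective (x≢ ∷ _) {zero}  {suc j} eq = contradiction eq (All.lookup x≢ (∈-lookup j))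
lookup-injective (x≢ ∷ _) {suc i} {zero}  eq = contradiction (sym eq) (All.lookup x≢ (∈-lookup i))
lookup-injective (_  ∷ u) {suc i} {suc j} eq = cong suc (lookup-injective u eq)

module _ {n} {P : Pred (Fin n) 0ℓ} (P? : Decidable P) {E : Rel (Fin n) 0ℓ}
  (E? : ∀ u v → Dec (E u v)) (E-sym : Symmetric E) {v : Fin n} (Pv : P v) where

  private
    vertices : List (Fin n)
    vertices = filter P? (allFin n)

    preimage : ∀ {v} → P v → ∃[ i ] lookup vertices i ≡ v
    preimage p = let v∈ = ∈-filter⁺ P? (∈-allFin _) p in Any.index v∈ , sym (lookup-index v∈)

  subgraph : Graph
  subgraph = record
    { order    = length vertices
    ; nonempty = inhabited⇒nonZero (proj₁ (preimage Pv))
    ; Adj      = λ i j → E (lookup vertices i) (lookup vertices j)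
    ; sym      = E-sym
    ; adj?     = λ _ _ → E? _ _
    }

  subgraph-embedding : Embedding subgraph P E
  subgraph-embedding = record
    { embed     = lookup vertices
    ; injective = lookup-injective (filter⁺ P? (allFin⁺ n))
    ; embed∈    = λ i → proj₂ (∈-filter⁻ P? {xs = allFin n} (∈-lookup i))
    ; preimage  = preimage
    ; adjacency = λ _ _ → ⇔-id _
    }

module _ {n} {F G H : Graph} {P Q : Pred (Fin n) 0ℓ} {D E : Rel (Fin n) 0ℓ}
  (f : Embedding F P D) (g : Embedding G Q E) where

  private
    module f = Embedding f
    module g = Embedding g

  module _ (h : Embedding H (λ v → P v ⊎ Q v) (λ u v → f.Within u v ⊎ g.Within u v))
    {R : REL (Vertex F) (Vertex G) 0ℓ} (meet : ∀ x y → R x y ⇔ f.embed x ≡ g.embed y) where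

    private
      module h = Embedding h

      place : Vertex F ⊎ Vertex G → Fin n
      place = [ f.embed , g.embed ]

      place∈ : ∀ p → P (place p) ⊎ Q (place p)
      place∈ (inj₁ x) = inj₁ (f.embed∈ x)
      place∈ (inj₂ y) = inj₂ (g.embed∈ y)

      project : Vertex F ⊎ Vertex G → Vertex H
      project p = proj₁ (h.preimage (place∈ p))

    embed-project : ∀ p → h.embed (project p) ≡ place p
    embed-project p = proj₂ (h.preimage (place∈ p))

    private
      place≡⇒project≡ : ∀ p {a} → place p ≡ h.embed a → project p ≡ a
      place≡⇒project≡ p eq = h.injective (trans (embed-project p) eq)

      Identify : Rel (Vertex F ⊎ Vertex G) 0ℓ
      Identify p q = ∃₂ λ x y → p ≡ inj₁ x × q ≡ inj₂ y × R x y

      place≡⇒closure : ∀ p q → place p ≡ place q → EqClosure Identify p q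
      place≡⇒closure (inj₁ x) (inj₁ y) eq with f.injective eq
      ... | refl = ε
      place≡⇒closure (inj₁ x) (inj₂ y) eq = fwd (_ , _ , refl , refl , Equivalence.from (meet x y) eq) ◅ ε
      place≡⇒closure (inj₂ x) (inj₁ y) eq = bwd (_ , _ , refl , refl , Equivalence.from (meet y x) (sym eq)) ◅ ε
      place≡⇒closure (inj₂ x) (inj₂ y) eq with g.injective eq
      ... | refl = ε

      closure⇒place≡ : ∀ {p q} → EqClosure Identify p q → place p ≡ place q
      closure⇒place≡ ε = refl
      closure⇒place≡ (fwd (x , y , refl , refl , r) ◅ rs) = trans (Equivalence.to (meet x y) r) (closure⇒place≡ rs)
      closure⇒place≡ (bwd (x , y , refl , refl , r) ◅ rs) = trans (sym (Equivalence.to (meet x y) r)) (closure⇒place≡ rs)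

    -- Two points of the disjoint union are identified exactly when they occupy the same place: on
    -- one side by injectivity, across the sides by `meet`. The quotient is therefore the union of
    -- the two images.
    union-gluing : Gluing F G R H
    union-gluing = record
      { project    = project
      ; surjective = λ a → let p , eq = cover a in p , λ { refl → place≡⇒project≡ p eq }
      ; kernel     = λ p q → mk⇔
          (λ eq → place≡⇒closure p q (trans (sym (embed-project p)) (trans (cong h.embed eq) (embed-project q))))
          (λ cl → place≡⇒project≡ p (trans (closure⇒place≡ cl) (sym (embed-project q))))
      ; adjacency  = λ a b → mk⇔ (split a b ∘ Equivalence.to (h.adjacency a b)) (join a b)
      }
      where
      cover : ∀ a → ∃[ p ] place p ≡ h.embed a
      cover a with h.embed∈ a
      ... | inj₁ p = let x , eq = f.preimage p in inj₁ x , eq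
      ... | inj₂ q = let y , eq = g.preimage q in inj₂ y , eq

      split : ∀ a b → f.Within (h.embed a) (h.embed b) ⊎ g.Within (h.embed a) (h.embed b) →
              ∃₂ λ p q → project p ≡ a × project q ≡ b × Pointwise (Adj F) (Adj G) p q
      split a b (inj₁ (p , q , e)) =
        let x , eq = f.preimage p ; y , eq′ = f.preimage q in
        inj₁ x , inj₁ y , place≡⇒project≡ (inj₁ x) eq , place≡⇒project≡ (inj₁ y) eq′ ,
        inj₁ (Equivalence.from (f.adjacency x y) (subst₂ D (sym eq) (sym eq′) e))
      split a b (inj₂ (p , q , e)) =
        let x , eq = g.preimage p ; y , eq′ = g.preimage q in
        inj₂ x , inj₂ y , place≡⇒project≡ (inj₂ x) eq , place≡⇒project≡ (inj₂ y) eq′ ,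
        inj₂ (Equivalence.from (g.adjacency x y) (subst₂ E (sym eq) (sym eq′) e))

      join : ∀ a b → (∃₂ λ p q → project p ≡ a × project q ≡ b × Pointwise (Adj F) (Adj G) p q) → Adj H a b
      join _ _ (p , q , refl , refl , pq) = Equivalence.from (h.adjacency _ _)
        (subst₂ (λ u v → f.Within u v ⊎ g.Within u v) (sym (embed-project p)) (sym (embed-project q)) (within pq))
        where
        within : ∀ {p q} → Pointwise (Adj F) (Adj G) p q → f.Within (place p) (place q) ⊎ g.Within (place p) (place q)
        within (inj₁ a) = inj₁ (f.embed∈ _ , f.embed∈ _ , Equivalence.to (f.adjacency _ _) a)
        within (inj₂ a) = inj₂ (g.embed∈ _ , g.embed∈ _ , Equivalence.to (g.adjacency _ _) a)

-- Series and parallel composition inside a fixed vertex set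

record Realised {n} (P : Pred (Fin n) 0ℓ) (E : Rel (Fin n) 0ℓ) (u v : Fin n) : Set₁ where
  field
    graph     : BilabelledGraph
    generated : L₁⁺ graph
    embedding : Embedding (underlying graph) P E
  open Embedding embedding public
  field
    inLabel≡  : embed (inLabel graph) ≡ u
    outLabel≡ : embed (outLabel graph) ≡ v

module _ {n} {P Q : Pred (Fin n) 0ℓ} {E E′ : Rel (Fin n) 0ℓ} {u v : Fin n}
  (P⇒Q : ∀ {v} → P v → Q v) (Q⇒P : ∀ {v} → Q v → P v)
  (E⇔E′ : ∀ {u v} → P u → P v → E u v ⇔ E′ u v) where

  -- This trades the `Union` relation produced by gluing for the adjacency of the ambient graph,
  -- with which it agrees only on the vertices of the piece.
  realised-cong : Realised P E u v → Realised Q E′ u v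
  realised-cong r = record
    { graph = graph
    ; generated = generated
    ; embedding = record
      { embed     = embed
      ; injective = injective
      ; embed∈    = P⇒Q ∘ embed∈
      ; preimage  = preimage ∘ Q⇒P
      ; adjacency = λ x y → mk⇔
          (Equivalence.to (E⇔E′ (embed∈ x) (embed∈ y)) ∘ Equivalence.to (adjacency x y))
          (Equivalence.from (adjacency x y) ∘ Equivalence.from (E⇔E′ (embed∈ x) (embed∈ y)))
      }
    ; inLabel≡  = inLabel≡
    ; outLabel≡ = outLabel≡
    }
    where open Realised r

module _ {n} {P Q : Pred (Fin n) 0ℓ} {D E : Rel (Fin n) 0ℓ} where

  Union : Rel (Fin n) 0ℓ
  Union x y = (P x × P y × D x y) ⊎ (Q x × Q y × E x y)

  private
    module Glued {a b c d} (r : Realised P D a b) (s : Realised Q E c d) where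
      module r = Realised r
      module s = Realised s

      union-sym : Symmetric Union
      union-sym = Sum.map r.within-sym s.within-sym

      union? : ∀ x y → Dec (Union x y)
      union? x y = r.within? x y ⊎-dec s.within? x y

      H : Graph
      H = subgraph (λ v → r.domain? v ⊎-dec s.domain? v) union? union-sym (inj₁ (r.embed∈ (inLabel r.graph)))

      h : Embedding H (λ v → P v ⊎ Q v) Union
      h = subgraph-embedding (λ v → r.domain? v ⊎-dec s.domain? v) union? union-sym (inj₁ (r.embed∈ (inLabel r.graph)))

  -- Since the two sets share only the common label, coincidence of places is exactly the
  -- identification that series composition prescribes.
  realised-series : ∀ {u v w} → Realised P D u v → Realised Q E v w →
                    (∀ {x} → P x → Q x → x ≡ v) →
                    Realised (λ x → P x ⊎ Q x) Union u w
  realised-series {v = v} r s P∩Q = record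
    { graph     = bilabelled H (project (inj₁ (inLabel r.graph))) (project (inj₂ (outLabel s.graph)))
    ; generated = series r.generated s.generated (record { gluing = gluing ; inLabel≡ = refl ; outLabel≡ = refl })
    ; embedding = h
    ; inLabel≡  = trans (embed-project r.embedding s.embedding h meet _) r.inLabel≡
    ; outLabel≡ = trans (embed-project r.embedding s.embedding h meet _) s.outLabel≡
    }
    where
    open Glued r s
    meet : ∀ x y → (x ≡ outLabel r.graph × y ≡ inLabel s.graph) ⇔ r.embed x ≡ s.embed y
    meet x y = mk⇔ (λ { (refl , refl) → trans r.outLabel≡ (sym s.inLabel≡) }) λ eq →
      let z≡v = P∩Q (r.embed∈ x) (subst Q (sym eq) (s.embed∈ y)) in
      r.injective (trans z≡v (sym r.outLabel≡)) , s.injective (trans (sym eq) (trans z≡v (sym s.inLabel≡)))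
    gluing = union-gluing r.embedding s.embedding h meet
    open Gluing gluing using (project)

  -- As for series composition, with both labels shared.
  realised-parallel : ∀ {u v} → Realised P D u v → Realised Q E u v →
                      (∀ {x} → P x → Q x → x ≡ u ⊎ x ≡ v) →
                      Realised (λ x → P x ⊎ Q x) Union u v
  realised-parallel {u} {v} r s P∩Q = record
    { graph     = bilabelled H (project (inj₁ (inLabel r.graph))) (project (inj₁ (outLabel r.graph)))
    ; generated = parallel r.generated s.generated (record { gluing = gluing ; inLabel≡ = refl ; outLabel≡ = refl })
    ; embedding = h
    ; inLabel≡  = trans (embed-project r.embedding s.embedding h meet _) r.inLabel≡
    ; outLabel≡ = trans (embed-project r.embedding s.embedding h meet _) r.outLabel≡
    }
    where
    open Glued r s
    meet : ∀ x y → ((x ≡ inLabel r.graph × y ≡ inLabel s.graph) ⊎ (x ≡ outLabel r.graph × y ≡ outLabel s.graph)) ⇔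
                   r.embed x ≡ s.embed y
    meet x y = mk⇔
      (λ { (inj₁ (refl , refl)) → trans r.inLabel≡ (sym s.inLabel≡)
         ; (inj₂ (refl , refl)) → trans r.outLabel≡ (sym s.outLabel≡) })
      λ eq → Sum.map
        (λ z≡u → r.injective (trans z≡u (sym r.inLabel≡)) , s.injective (trans (sym eq) (trans z≡u (sym s.inLabel≡))))
        (λ z≡v → r.injective (trans z≡v (sym r.outLabel≡)) , s.injective (trans (sym eq) (trans z≡v (sym s.outLabel≡))))
        (P∩Q (r.embed∈ x) (subst Q (sym eq) (s.embed∈ y)))
    gluing = union-gluing r.embedding s.embedding h meet
    open Gluing gluing using (project)

realised-all⇒UnderliesL₁⁺ : ∀ {F} {P : Pred (Vertex F) 0ℓ} {u v} → (∀ x → P x) →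
                            Realised P (Adj F) u v → UnderliesL₁⁺ F
realised-all⇒UnderliesL₁⁺ all r = graph , generated , record
  { bijection = mk↔ₛ′ embed (λ v → proj₁ (preimage (all v))) (λ v → proj₂ (preimage (all v)))
                  (λ x → injective (proj₂ (preimage (all (embed x)))))
  ; adjacency = adjacency
  }
  where open Realised r

-- 2-trees

module _ {n : ℕ} where

  -- The definition is inductive-recursive because `attach` refers to an edge and to the vertices of
  -- the tree built so far.
  data TwoTree : Set
  Edge : TwoTree → Set
  -- The two edges at an attached vertex are oriented as a path from the source of the chosen edge
  -- to its target, so that their pieces compose in series.
  source target : ∀ K → Edge K → Fin n
  _∈ᴷ_ : Fin n → TwoTree → Set

  -- The empty and the one-vertex tree serve as initial stages of the construction.
  data TwoTree where
    empty  : TwoTree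
    single : Fin n → TwoTree
    edge   : (a b : Fin n) → a ≢ b → TwoTree
    attach : ∀ K w → Edge K → ¬ w ∈ᴷ K → TwoTree

  Edge empty            = ⊥
  Edge (single _)       = ⊥
  Edge (edge _ _ _)     = ⊤
  Edge (attach K _ _ _) = Edge K ⊎ Bool

  pattern old e = inj₁ e
  pattern toNew   = inj₂ true
  pattern fromNew = inj₂ false

  source (edge a _ _)     _       = a
  source (attach K _ _ _) (old e) = source K e
  source (attach K _ e _) toNew   = source K e
  source (attach _ w _ _) fromNew = w

  target (edge _ b _)     _       = b
  target (attach K _ _ _) (old e) = target K e
  target (attach _ w _ _) toNew   = w
  target (attach K _ e _) fromNew = target K e

  v ∈ᴷ empty          = ⊥
  v ∈ᴷ single a       = v ≡ a
  v ∈ᴷ edge a b _     = v ≡ a ⊎ v ≡ b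
  v ∈ᴷ attach K w _ _ = v ≡ w ⊎ v ∈ᴷ K

  _∈ᴷ?_ : ∀ v K → Dec (v ∈ᴷ K)
  v ∈ᴷ? empty          = no id
  v ∈ᴷ? single a       = v ≟ a
  v ∈ᴷ? edge a b _     = v ≟ a ⊎-dec v ≟ b
  v ∈ᴷ? attach K w _ _ = v ≟ w ⊎-dec v ∈ᴷ? K

  _≟ᴱ_ : ∀ {K} → DecidableEquality (Edge K)
  _≟ᴱ_ {edge _ _ _}     = λ _ _ → yes refl
  _≟ᴱ_ {attach _ _ _ _} = Sumₚ.≡-dec _≟ᴱ_ Bool._≟_

  End : ∀ K → Edge K → Fin n → Set
  End K e v = v ≡ source K e ⊎ v ≡ target K e

  end∈ : ∀ K e {v} → End K e v → v ∈ᴷ K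
  end∈ (edge _ _ _)     _       end         = end
  end∈ (attach K _ _ _) (old e) end         = inj₂ (end∈ K e end)
  end∈ (attach K _ e _) toNew   (inj₁ refl) = inj₂ (end∈ K e (inj₁ refl))
  end∈ (attach _ _ _ _) toNew   (inj₂ refl) = inj₁ refl
  end∈ (attach _ _ _ _) fromNew (inj₁ refl) = inj₁ refl
  end∈ (attach K _ e _) fromNew (inj₂ refl) = inj₂ (end∈ K e (inj₂ refl))

  source≢target : ∀ K e → source K e ≢ target K e
  source≢target (edge _ _ a≢b)     _       = a≢b
  source≢target (attach K _ _ _)   (old e) = source≢target K e
  source≢target (attach K _ e w∉K) toNew   = λ { refl → w∉K (end∈ K e (inj₁ refl)) }
  source≢target (attach K _ e w∉K) fromNew = λ { refl → w∉K (end∈ K e (inj₂ refl)) }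

  -- The given edge excludes the one-vertex tree, whose vertex lies on no edge.
  incident : ∀ K → Edge K → ∀ {v} → v ∈ᴷ K → ∃[ e ] End K e v
  incident (edge _ _ _)     _ v∈          = tt , v∈
  incident (attach _ _ _ _) _ (inj₁ refl) = toNew , inj₂ refl
  incident (attach K _ e _) _ (inj₂ v∈)   = let f , end = incident K e v∈ in old f , end

  -- Equality is included so that loops count as joined and `Clique` may range over equal vertices.
  Joined : TwoTree → Rel (Fin n) 0ℓ
  Joined K u v = u ≡ v ⊎ ∃[ e ] (End K e u × End K e v)

  joined-sym : ∀ {K} → Symmetric (Joined K)
  joined-sym (inj₁ eq)          = inj₁ (sym eq)
  joined-sym (inj₂ (e , u , v)) = inj₂ (e , v , u)

  Clique : TwoTree → Pred (Fin n) 0ℓ → Set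
  Clique K C = ∀ {u v} → C u → C v → Joined K u v

  -- Two distinct joined vertices are the ends of an edge by definition, and a single vertex has an
  -- incident edge. `e` is the answer for the empty clique.
  clique⊆edge : ∀ K → Edge K → ∀ C → length C ≤ 2 → (∀ {v} → v ∈ C → v ∈ᴷ K) → Clique K (_∈ C) →
                ∃[ e ] (∀ {v} → v ∈ C → End K e v)
  clique⊆edge K e [] _ _ _ = e , λ ()
  clique⊆edge K e (c ∷ []) _ C⊆K _ = let f , end = incident K e (C⊆K (here refl)) in
    f , λ { (here refl) → end }
  clique⊆edge K e (c ∷ d ∷ []) _ C⊆K cl with cl (here refl) (there (here refl))
  ... | inj₁ refl = let f , end = incident K e (C⊆K (here refl)) in
    f , λ { (here refl) → end ; (there (here refl)) → end }
  ... | inj₂ (f , endᶜ , endᵈ) = f , λ { (here refl) → endᶜ ; (there (here refl)) → endᵈ }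
  clique⊆edge _ _ (_ ∷ _ ∷ _ ∷ _) (s≤s (s≤s ()))

  record ExtendedBy (K : TwoTree) (w : Fin n) (C : Pred (Fin n) 0ℓ) : Set where
    field
      tree   : TwoTree
      new∈   : w ∈ᴷ tree
      old∈   : ∀ {v} → v ∈ᴷ K → v ∈ᴷ tree
      ∈⁻     : ∀ {v} → v ∈ᴷ tree → v ≡ w ⊎ v ∈ᴷ K
      mono   : ∀ {u v} → Joined K u v → Joined tree u v
      joined : ∀ {v} → C v → Joined tree v w

  attachTo : ∀ K w → ¬ w ∈ᴷ K → ∀ {C : Pred (Fin n) 0ℓ} → ∃[ e ] (∀ {v} → C v → End K e v) → ExtendedBy K w C
  attachTo K w w∉K (e , C⊆e) = record
    { tree   = attach K w e w∉K
    ; new∈   = inj₁ refl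
    ; old∈   = inj₂
    ; ∈⁻     = id
    ; mono   = Sum.map₂ (λ (f , ends) → old f , ends)
    ; joined = λ v∈C → inj₂
        ([ (λ v≡s → toNew , inj₁ v≡s , inj₂ refl) , (λ v≡t → fromNew , inj₂ v≡t , inj₁ refl) ] (C⊆e v∈C))
    }

  -- Once `K` has an edge, the clique `C` lies on one, and attaching `w` there joins it to all of
  -- `C`. The two edgeless trees are extended by hand.
  extend : ∀ K w → ¬ w ∈ᴷ K → ∀ C → length C ≤ 2 → (∀ {v} → v ∈ C → v ∈ᴷ K) → Clique K (_∈ C) →
           ExtendedBy K w (_∈ C)
  extend empty w _ C _ C⊆K _ = record
    { tree = single w ; new∈ = refl ; old∈ = λ () ; ∈⁻ = inj₁
    ; mono = λ { (inj₁ eq) → inj₁ eq } ; joined = ⊥-elim ∘ C⊆K }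
  extend (single a) w w∉K C _ C⊆K _ = record
    { tree = edge a w (w∉K ∘ sym) ; new∈ = inj₂ refl ; old∈ = inj₁ ; ∈⁻ = Sum.swap
    ; mono = λ { (inj₁ eq) → inj₁ eq } ; joined = λ v∈C → inj₂ (tt , inj₁ (C⊆K v∈C) , inj₂ refl) }
  extend K@(edge _ _ _) w w∉K C ∣C∣≤2 C⊆K cl = attachTo K w w∉K (clique⊆edge K tt C ∣C∣≤2 C⊆K cl)
  extend K@(attach _ _ e _) w w∉K C ∣C∣≤2 C⊆K cl = attachTo K w w∉K (clique⊆edge K (old e) C ∣C∣≤2 C⊆K cl)

-- Elimination of the attached vertices

-- The invariant of the elimination: vertices of `F` outside `K` have been absorbed into pieces, and
-- pieces meet only in `K`. A piece carries the whole induced subgraph, loops included, so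
-- `coversEdge` asks nothing of loops.
record Pieces (F : Graph) (K : TwoTree) : Set₁ where
  field
    piece      : Edge K → Pred (Vertex F) 0ℓ
    ends⊆      : ∀ e {v} → End K e v → piece e v
    interior   : ∀ e {v} → piece e v → v ∈ᴷ K → End K e v
    disjoint    : ∀ {e f v} → piece e v → piece f v → e ≡ f ⊎ v ∈ᴷ K
    covers     : ∀ v → ∃ (λ e → piece e v) ⊎ v ∈ᴷ K
    coversEdge : ∀ {u v} → Adj F u v → u ≡ v ⊎ ∃[ e ] (piece e u × piece e v)
    realised   : ∀ e → Realised (piece e) (Adj F) (source K e) (target K e)

-- Removing w, which was attached to the edge e₀ = ab, turns the piece of
-- ab into ab ⊙ (aw · wb).
module _ {F : Graph} {K : TwoTree} {w : Vertex F} {e₀ : Edge K} {w∉K : ¬ w ∈ᴷ K}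
  (pieces : Pieces F (attach K w e₀ w∉K)) where

  private
    open Pieces pieces
    K′ : TwoTree
    K′ = attach K w e₀ w∉K

    Detour : Pred (Vertex F) 0ℓ
    Detour v = piece toNew v ⊎ piece fromNew v

    piece′ : Edge K → Pred (Vertex F) 0ℓ
    piece′ e v = piece (old e) v ⊎ (e ≡ e₀ × Detour v)

    squash : Edge K′ → Edge K
    squash (old e)  = e
    squash (inj₂ _) = e₀

    ⊆squash : ∀ e {v} → piece e v → piece′ (squash e) v
    ⊆squash (old _)  p = inj₁ p
    ⊆squash toNew   p = inj₂ (refl , inj₁ p)
    ⊆squash fromNew p = inj₂ (refl , inj₂ p)

    end-old : ∀ {e v} → piece (old e) v → v ∈ᴷ K′ → v ∈ᴷ K
    end-old {e} p v∈ = end∈ K e (interior (old e) p v∈)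

    -- The vertex is an end of one of the two new edges; it is not `w`, which lies outside `K`, so
    -- it is an end of `e₀`.
    detour∩K : ∀ {v} → Detour v → v ∈ᴷ K → End K e₀ v
    detour∩K (inj₁ p) v∈ with interior toNew p (inj₂ v∈)
    ... | inj₁ v≡a  = inj₁ v≡a
    ... | inj₂ refl = contradiction v∈ w∉K
    detour∩K (inj₂ p) v∈ with interior fromNew p (inj₂ v∈)
    ... | inj₁ refl = contradiction v∈ w∉K
    ... | inj₂ v≡b  = inj₂ v≡b

    -- Pieces of different edges meet only in `K′`, and an old piece meets `K′` only in ends of its
    -- old edge.
    detour-disjoint : ∀ {e v} → Detour v → piece (old e) v → v ∈ᴷ K
    detour-disjoint (inj₁ p) q with disjoint p q
    ... | inj₂ v∈ = end-old q v∈
    detour-disjoint (inj₂ p) q with disjoint p q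
    ... | inj₂ v∈ = end-old q v∈

    interior′ : ∀ e {v} → piece′ e v → v ∈ᴷ K → End K e v
    interior′ e (inj₁ p)          v∈ = interior (old e) p (inj₂ v∈)
    interior′ e (inj₂ (refl , d)) v∈ = detour∩K d v∈

    disjoint′ : ∀ {e f v} → piece′ e v → piece′ f v → e ≡ f ⊎ v ∈ᴷ K
    disjoint′ (inj₁ p) (inj₁ q) with disjoint p q
    ... | inj₁ refl = inj₁ refl
    ... | inj₂ v∈   = inj₂ (end-old p v∈)
    disjoint′ (inj₁ p)          (inj₂ (_ , d))    = inj₂ (detour-disjoint d p)
    disjoint′ (inj₂ (_ , d))    (inj₁ q)          = inj₂ (detour-disjoint d q)
    disjoint′ (inj₂ (refl , _)) (inj₂ (refl , _)) = inj₁ refl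

    covers′ : ∀ v → ∃ (λ e → piece′ e v) ⊎ v ∈ᴷ K
    covers′ v with covers v
    ... | inj₁ (e , p)     = inj₁ (squash e , ⊆squash e p)
    ... | inj₂ (inj₁ refl) = inj₁ (e₀ , inj₂ (refl , inj₁ (ends⊆ toNew (inj₂ refl))))
    ... | inj₂ (inj₂ v∈)   = inj₂ v∈

    -- A common vertex is an end of both aw and wb; as a and b differ, it is w.
    series∩ : ∀ {v} → piece toNew v → piece fromNew v → v ≡ w
    series∩ p q with disjoint p q
    ... | inj₂ v∈ with interior toNew p v∈ | interior fromNew q v∈
    ... | inj₂ v≡w  | _        = v≡w
    ... | inj₁ _    | inj₁ v≡w = v≡w
    ... | inj₁ refl | inj₂ a≡b = contradiction a≡b (source≢target K e₀)

    detour : Realised Detour Union (source K e₀) (target K e₀)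
    detour = realised-series (realised toNew) (realised fromNew) series∩

    merged : Realised (λ v → Detour v ⊎ piece (old e₀) v) Union (source K e₀) (target K e₀)
    merged = realised-parallel detour (realised (old e₀)) λ d p → detour∩K d (detour-disjoint d p)

    realised′ : ∀ e → Realised (piece′ e) (Adj F) (source K e) (target K e)
    realised′ e with e ≟ᴱ e₀
    ... | no e≢e₀ = realised-cong inj₁ [ id , (λ (e≡e₀ , _) → contradiction e≡e₀ e≢e₀) ] (λ _ _ → ⇔-id _) (realised (old e))
    -- `merged` has only edges inside one of its three pieces; `remember` shows that no edge of `F`
    -- between its vertices is lost.
    ... | yes refl = realised-cong [ (λ d → inj₂ (refl , d)) , inj₁ ] to′
          (λ u v → mk⇔ forget (remember u v)) merged
      where
      Merged : Pred (Vertex F) 0ℓ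
      Merged v = Detour v ⊎ piece (old e₀) v

      to′ : ∀ {v} → piece′ e₀ v → Merged v
      to′ (inj₁ p)       = inj₂ p
      to′ (inj₂ (_ , d)) = inj₁ d

      forget : ∀ {u v} → _ → Adj F u v
      forget (inj₁ (_ , _ , inj₁ (_ , _ , a))) = a
      forget (inj₁ (_ , _ , inj₂ (_ , _ , a))) = a
      forget (inj₂ (_ , _ , a))                = a

      within-piece : ∀ {u v} → Adj F u v → ∀ e → piece e u → piece e v → Merged u → Merged v → _
      within-piece a toNew   p q _ _ = inj₁ (inj₁ p , inj₁ q , inj₁ (p , q , a))
      within-piece a fromNew p q _ _ = inj₁ (inj₂ p , inj₂ q , inj₂ (p , q , a))
      within-piece a (old f) p q u v = inj₂ (pull f p u , pull f q v , a)
        where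
        -- The edge may be recorded in the piece of another old edge `f`. A detour vertex lying
        -- there is an end of `e₀`, hence also in the piece of `e₀`.
        pull : ∀ f {v} → piece (old f) v → Merged v → piece (old e₀) v
        pull f p (inj₁ d) = ends⊆ (old e₀) (detour∩K d (detour-disjoint d p))
        pull f p (inj₂ q) = q

      remember : ∀ {u v} → Merged u → Merged v → Adj F u v → _
      remember u v a with coversEdge a
      ... | inj₂ (e , p , q) = within-piece a e p q u v
      -- A loop belongs to whichever piece holds its vertex.
      remember (inj₂ p) _ a | inj₁ refl = inj₂ (p , p , a)
      remember (inj₁ (inj₁ p)) v a | inj₁ refl = within-piece a toNew p p v v
      remember (inj₁ (inj₂ p)) v a | inj₁ refl = within-piece a fromNew p p v v

  eliminate : Pieces F K
  eliminate = record
    { piece      = piece′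
    ; ends⊆      = λ e end → inj₁ (ends⊆ (old e) end)
    ; interior   = interior′
    ; disjoint    = disjoint′
    ; covers     = covers′
    ; coversEdge = Sum.map₂ (λ (e , p , q) → squash e , ⊆squash e p , ⊆squash e q) ∘ coversEdge
    ; realised   = realised′
    }

-- When one edge is left, its piece is all of `F`, since the remaining vertices of `K` are its ends.
-- The edge argument rules out the edgeless trees.
Pieces⇒UnderliesL₁⁺ : ∀ {F} K → Edge K → Pieces F K → UnderliesL₁⁺ F
Pieces⇒UnderliesL₁⁺ (edge a b _) _ pieces = realised-all⇒UnderliesL₁⁺ all (realised tt)
  where
  open Pieces pieces
  all : ∀ v → piece tt v
  all v with covers v
  ... | inj₁ (tt , p) = p
  ... | inj₂ v∈       = ends⊆ tt v∈
Pieces⇒UnderliesL₁⁺ (attach K w e w∉K) _ pieces = Pieces⇒UnderliesL₁⁺ K e (eliminate pieces)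

-- F is a spanning subgraph of K, up to loops.
Spans : (F : Graph) (K : TwoTree {Graph.order F}) → Set
Spans F K = (∀ v → v ∈ᴷ K) × (∀ {u v} → Adj F u v → Joined K u v)

-- Initially a piece is just the two ends of its edge, and the subgraph of `F` induced on them is
-- atomic.
spans⇒Pieces : ∀ {F K} → Spans F K → Pieces F K
spans⇒Pieces {F} {K} (spanning , joined) = record
  { piece      = End K
  ; ends⊆      = λ _ → id
  ; interior   = λ _ end _ → end
  ; disjoint    = λ {e} end _ → inj₂ (spanning _)
  ; covers     = λ v → inj₂ (spanning v)
  ; coversEdge = joined
  ; realised   = λ e → record
    { graph     = bilabelled (subgraph (end? e) (Graph.adj? F) (Graph.sym F) (inj₁ refl))
                    (proj₁ (Embedding.preimage (emb e) (inj₁ refl))) (proj₁ (Embedding.preimage (emb e) (inj₂ refl)))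
    ; generated = atomic (λ x → Sum.map
        (λ eq → Embedding.injective (emb e) (trans eq (sym (proj₂ (Embedding.preimage (emb e) (inj₁ refl))))))
        (λ eq → Embedding.injective (emb e) (trans eq (sym (proj₂ (Embedding.preimage (emb e) (inj₂ refl))))))
        (Embedding.embed∈ (emb e) x))
    ; embedding = emb e
    ; inLabel≡  = proj₂ (Embedding.preimage (emb e) (inj₁ refl))
    ; outLabel≡ = proj₂ (Embedding.preimage (emb e) (inj₂ refl))
    }
  }
  where
  end? : ∀ e → Decidable (End K e)
  end? e v = v ≟ source K e ⊎-dec v ≟ target K e
  emb : ∀ e → Embedding _ (End K e) (Adj F)
  emb e = subgraph-embedding (end? e) (Graph.adj? F) (Graph.sym F) (inj₁ refl)

graph-vertex : (F : Graph) → Vertex F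
graph-vertex record { order = suc _ } = zero

spans⇒UnderliesL₁⁺ : ∀ {F} K → Spans F K → UnderliesL₁⁺ F
spans⇒UnderliesL₁⁺ {F} empty (spanning , _) = ⊥-elim (spanning (graph-vertex F))
spans⇒UnderliesL₁⁺ {F} (single a) (spanning , _) =
  bilabelled F a a , atomic (inj₁ ∘ spanning) , record { bijection = ↔-id _ ; adjacency = λ _ _ → ⇔-id _ }
spans⇒UnderliesL₁⁺ K@(edge _ _ _)     spans = Pieces⇒UnderliesL₁⁺ K tt (spans⇒Pieces spans)
spans⇒UnderliesL₁⁺ K@(attach _ _ e _) spans = Pieces⇒UnderliesL₁⁺ K (old e) (spans⇒Pieces spans)

-- Edges of a tree are bridges

module _ {n} {R : Rel (Fin n) 0ℓ} {e : Fin n} where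

  open import Data.List.Membership.DecPropositional (_≟_ {n}) using (_∈?_)

  -- The list omits the start, so that `x ∷ zs` has the form of the vertex list in `Cycle`.
  data Path : Fin n → List (Fin n) → Set where
    []  : Path e []
    _∷_ : ∀ {x y zs} → R x y → Path y zs → Path x (y ∷ zs)

  SimplePath : Fin n → Set
  SimplePath x = ∃[ zs ] (Path x zs × Unique (x ∷ zs))

  suffix : ∀ {x y zs} → x ∈ y ∷ zs → Path y zs → Unique (y ∷ zs) → SimplePath x
  suffix (here refl) p       u       = _ , p , u
  suffix (there x∈)  (_ ∷ p) (_ ∷ u) = suffix x∈ p u

  -- Loop erasure: if the new first vertex already occurs on the path, the path is cut back to that
  -- occurrence.
  simplify : ∀ {x} → Star R x e → SimplePath x
  simplify ε = [] , [] , [] ∷ []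
  simplify {x} (_◅_ {j = y} r rs) with simplify rs
  ... | zs , p , u with x ∈? (y ∷ zs)
  ... | yes x∈ = suffix x∈ p u
  ... | no x∉  = y ∷ zs , r ∷ p , All.¬Any⇒All¬ _ x∉ ∷ u

  close : ∀ {S : Rel (Fin n) 0ℓ} {x zs z} → (∀ {x y} → R x y → S x y) → Path x zs → S e z → Linked S (x ∷ zs ++ z ∷ [])
  close f []      s = s ∷ [-]
  close f (r ∷ p) s = f r ∷ close f p s

-- Make the walk simple. Length zero would give a loop, length one is the forbidden step, and a
-- longer path closes to a cycle along the edge from `b` to `a`.
bridge : ∀ {T} → IsTree T → ∀ {a b} → Adj T a b →
         ¬ Star (λ x y → Adj T x y × ¬ (x ≡ a × y ≡ b)) a b
bridge {T} isTree {a} {b} ab walk with simplify walk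
... | [] , [] , _ = IsTree.loopless isTree refl ab
... | _ ∷ [] , (_ , ≢ab) ∷ [] , _ = ≢ab (refl , refl)
... | x ∷ y ∷ zs , p , u = IsTree.acyclic isTree record
  { start    = a
  ; rest     = x ∷ y ∷ zs
  ; long     = s≤s (s≤s (s≤s z≤n))
  ; distinct = u
  ; closed   = close proj₁ p (Graph.sym T ab)
  }

-- Growing a 2-tree along a tree decomposition

elements : ∀ {n} → Subset n → List (Fin n)
elements []            = []
elements (inside ∷ p)  = zero ∷ map suc (elements p)
elements (outside ∷ p) = map suc (elements p)

length-elements : ∀ {n} (p : Subset n) → length (elements p) ≡ ∣ p ∣
length-elements []            = refl
length-elements (inside ∷ p)  = cong suc (trans (length-map suc (elements p)) (length-elements p))
length-elements (outside ∷ p) = trans (length-map suc (elements p)) (length-elements p)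

∈-elements⁺ : ∀ {n} {p : Subset n} {v} → v ∈ˢ p → v ∈ elements p
∈-elements⁺ here = here refl
∈-elements⁺ {p = inside ∷ _}  (there v∈) = there (∈-map⁺ suc (∈-elements⁺ v∈))
∈-elements⁺ {p = outside ∷ _} (there v∈) = ∈-map⁺ suc (∈-elements⁺ v∈)

∈-elements⁻ : ∀ {n} {p : Subset n} {v} → v ∈ elements p → v ∈ˢ p
∈-elements⁻ {p = inside ∷ _}  (here refl) = here
∈-elements⁻ {p = inside ∷ _}  (there v∈) with ∈-map⁻ suc v∈
... | _ , u∈ , refl = there (∈-elements⁻ u∈)
∈-elements⁻ {p = outside ∷ _} v∈ with ∈-map⁻ suc v∈
... | _ , u∈ , refl = there (∈-elements⁻ u∈)

module _ {n} (L : List (Fin n)) (∣L∣≤3 : length L ≤ 3) where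

  MeetsInClique : TwoTree → Set
  MeetsInClique K = Clique K (λ v → v ∈ L × v ∈ᴷ K)

  record Absorbed (K : TwoTree) (xs : List (Fin n)) : Set where
    field
      tree   : TwoTree
      old∈   : ∀ {v} → v ∈ᴷ K → v ∈ᴷ tree
      new∈   : ∀ {v} → v ∈ xs → v ∈ᴷ tree
      ∈⁻     : ∀ {v} → v ∈ᴷ tree → v ∈ L ⊎ v ∈ᴷ K
      mono   : ∀ {u v} → Joined K u v → Joined tree u v
      clique : MeetsInClique tree

  -- The recursion is on `xs`, while the clique condition concerns all of `L`: the entries of `L`
  -- present so far are pairwise joined, and each new one is joined to all of them.
  absorb : ∀ xs → (∀ {v} → v ∈ xs → v ∈ L) → ∀ K → MeetsInClique K → Absorbed K xs
  absorb [] _ K cl = record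
    { tree = K ; old∈ = id ; new∈ = λ () ; ∈⁻ = inj₂ ; mono = id ; clique = cl }
  absorb (w ∷ xs) xs⊆L K cl with w ∈ᴷ? K
  ... | yes w∈K = record
    { tree = tree ; old∈ = old∈ ; new∈ = λ { (here refl) → old∈ w∈K ; (there v∈) → new∈ v∈ }
    ; ∈⁻ = ∈⁻ ; mono = mono ; clique = clique }
    where open Absorbed (absorb xs (xs⊆L ∘ there) K cl)
  ... | no w∉K = record
    { tree   = tree
    ; old∈   = old∈ ∘ E.old∈
    ; new∈   = λ { (here refl) → old∈ E.new∈ ; (there v∈) → new∈ v∈ }
    ; ∈⁻     = [ inj₁ , [ (λ { refl → inj₁ w∈L }) , inj₂ ] ∘ E.∈⁻ ] ∘ ∈⁻
    ; mono   = mono ∘ E.mono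
    ; clique = clique
    }
    where
    w∈L : w ∈ L
    w∈L = xs⊆L (here refl)

    C : List (Fin n)
    C = filter (_∈ᴷ? K) L

    C⁻ : ∀ {v} → v ∈ C → v ∈ L × v ∈ᴷ K
    C⁻ = ∈-filter⁻ (_∈ᴷ? K)

    module E = ExtendedBy (extend K w w∉K C
      -- The filter drops at least `w` from at most three entries, which leaves at most two.
      (s≤s⁻¹ (≤-trans (filter-notAll (_∈ᴷ? K) L (lose w∈L w∉K)) ∣L∣≤3))
      (proj₂ ∘ C⁻) (λ u∈ v∈ → cl (C⁻ u∈) (C⁻ v∈)))

    joined : ∀ {v} → v ∈ L → v ∈ᴷ K → Joined E.tree v w
    joined v∈L v∈K = E.joined (∈-filter⁺ (_∈ᴷ? K) v∈L v∈K)

    clique′ : MeetsInClique E.tree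
    clique′ (u∈L , u∈) (v∈L , v∈) with E.∈⁻ u∈ | E.∈⁻ v∈
    ... | inj₁ refl | inj₁ refl = inj₁ refl
    ... | inj₁ refl | inj₂ v∈K  = joined-sym (joined v∈L v∈K)
    ... | inj₂ u∈K  | inj₁ refl = joined u∈L u∈K
    ... | inj₂ u∈K  | inj₂ v∈K  = E.mono (cl (u∈L , u∈K) (v∈L , v∈K))

    open Absorbed (absorb xs (xs⊆L ∘ there) E.tree clique′)

-- Traversal of the decomposition tree

module _ {F : Graph} (D : TreeDecomposition F) (width≤2 : width D ≤ 2) where

  open TreeDecomposition D hiding (width)
  open import Data.List.Membership.DecPropositional (_≟_ {Graph.order tree}) using (_∈?_)

  ∣bag∣≤3 : ∀ t → length (elements (bag t)) ≤ 3
  ∣bag∣≤3 t = ≤-trans (≤-reflexive (length-elements (bag t)))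
    (≤-trans (All.lookup (All.map⁻ (xs≤max 0 (map (λ t → ∣ bag t ∣) (allFin _)))) (∈-allFin t))
      -- The inequality m ≤ 1 + (m ∸ 1) also holds when the subtraction truncates.
      (≤-trans (m≤n+m∸n _ 1) (s≤s width≤2)))

  record Explored : Set where
    field
      visited   : List (Vertex tree)
      connects  : InducedConnected tree (_∈ visited)
      twoTree   : TwoTree
      ∈⇒bag     : ∀ {v} → v ∈ᴷ twoTree → ∃[ t ] (t ∈ visited × v ∈ˢ bag t)
      bag⇒∈     : ∀ {t v} → t ∈ visited → v ∈ˢ bag t → v ∈ᴷ twoTree
      bagClique : ∀ {t} → t ∈ visited → Clique twoTree (_∈ˢ bag t)

  open Explored

  start : Explored
  start = record
    { visited = [] ; connects = λ () ; twoTree = empty ; ∈⇒bag = λ () ; bag⇒∈ = λ () ; bagClique = λ () }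

  add : ∀ (X : Explored) t → InducedConnected tree (_∈ t ∷ visited X) →
        Clique (twoTree X) (λ v → v ∈ˢ bag t × v ∈ᴷ twoTree X) →
        Σ[ Y ∈ Explored ] visited Y ≡ t ∷ visited X
  add X t connects′ cl = Y , refl
    where
    L = elements (bag t)
    module A = Absorbed (absorb L (∣bag∣≤3 t) L id (twoTree X)
      (λ (u∈L , u∈) (v∈L , v∈) → cl (∈-elements⁻ u∈L , u∈) (∈-elements⁻ v∈L , v∈)))
    Y : Explored
    Y = record
      { visited   = t ∷ visited X
      ; connects  = connects′
      ; twoTree   = A.tree
      ; ∈⇒bag     = λ v∈ → [ (λ v∈L → t , here refl , ∈-elements⁻ v∈L)
                           , (λ v∈ → let s , s∈ , v∈s = ∈⇒bag X v∈ in s , there s∈ , v∈s) ] (A.∈⁻ v∈)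
      ; bag⇒∈     = λ { (here refl) v∈ → A.new∈ (∈-elements⁺ v∈)
                      ; (there s∈)  v∈ → A.old∈ (bag⇒∈ X s∈ v∈) }
      ; bagClique = λ { (here refl) u∈ v∈ → A.clique (∈-elements⁺ u∈ , A.new∈ (∈-elements⁺ u∈))
                                                     (∈-elements⁺ v∈ , A.new∈ (∈-elements⁺ v∈))
                      ; (there s∈)  u∈ v∈ → A.mono (bagClique X s∈ u∈ v∈) }
      }

  -- Otherwise walk from `t` through bags containing `v` to a visited node, then through visited
  -- nodes to `s`. The first part never reaches `s` and the second never leaves from `t`, so the
  -- edge from `t` to `s` is bypassed although it is a bridge.
  running-intersection : ∀ (X : Explored) {s t} → s ∈ visited X → ¬ t ∈ visited X → Adj tree s t →
                         ∀ {v} → v ∈ˢ bag t → v ∈ᴷ twoTree X → v ∈ˢ bag s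
  running-intersection X {s} {t} s∈ t∉ st {v} v∈t v∈X with v ∈ˢ? bag s
  ... | yes v∈s = v∈s
  ... | no v∉s  = let r , r∈ , v∈r = ∈⇒bag X v∈X in
    contradiction
      (Star.map (λ { (_ , v∈y , xy) → xy , λ { (_ , refl) → v∉s v∈y } }) (connected v v∈t v∈r) ◅◅
       Star.map (λ { (x∈ , _ , xy) → xy , λ { (refl , _) → t∉ x∈ } }) (connects X r∈ s∈))
      (bridge isTree (Graph.sym tree st))

  connects-add : ∀ (X : Explored) {s t} → s ∈ visited X → Adj tree s t → InducedConnected tree (_∈ t ∷ visited X)
  connects-add X {s} {t} s∈ st = go
    where
    grow : ∀ {x y} → x ∈ visited X → y ∈ visited X →
           Star (λ a b → a ∈ t ∷ visited X × b ∈ t ∷ visited X × Adj tree a b) x y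
    grow x∈ y∈ = Star.map (λ (a∈ , b∈ , ab) → there a∈ , there b∈ , ab) (connects X x∈ y∈)

    go : InducedConnected tree (_∈ t ∷ visited X)
    go (here refl) (here refl) = ε
    go (here refl) (there y∈)  = (here refl , there s∈ , Graph.sym tree st) ◅ grow s∈ y∈
    go (there x∈)  (here refl) = grow x∈ s∈ ◅◅ (there s∈ , here refl , st) ◅ ε
    go (there x∈)  (there y∈)  = grow x∈ y∈

  _⊑_ : Explored → Explored → Set
  X ⊑ Y = ∀ {t} → t ∈ visited X → t ∈ visited Y

  step : ∀ X {s t} → s ∈ visited X → Adj tree s t → Σ[ Y ∈ Explored ] (X ⊑ Y × t ∈ visited Y)
  step X {s} {t} s∈ st with t ∈? visited X
  ... | yes t∈ = X , id , t∈
  -- The vertices of the new bag that are already present lie in the bag of `s`, which is a clique.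
  ... | no t∉ with add X t (connects-add X s∈ st) (λ (u∈ , u∈X) (v∈ , v∈X) →
        bagClique X s∈ (running-intersection X s∈ t∉ st u∈ u∈X) (running-intersection X s∈ t∉ st v∈ v∈X))
  ... | Y , refl = Y , there , here refl

  follow : ∀ X {s t} → s ∈ visited X → Star (Adj tree) s t → Σ[ Y ∈ Explored ] (X ⊑ Y × t ∈ visited Y)
  follow X s∈ ε = X , id , s∈
  follow X s∈ (st ◅ walk) =
    let Y , X⊑Y , t∈ = step X s∈ st ; Z , Y⊑Z , u∈ = follow Y t∈ walk in Z , Y⊑Z ∘ X⊑Y , u∈

  -- Each node is reached by its own walk from `r`; these walks may overlap, since `step` leaves
  -- visited nodes alone.
  visitAll : ∀ X {r} → r ∈ visited X → ∀ ts → Σ[ Y ∈ Explored ] (X ⊑ Y × (∀ {t} → t ∈ ts → t ∈ visited Y))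
  visitAll X r∈ [] = X , id , λ ()
  visitAll X r∈ (t ∷ ts) =
    let Y , X⊑Y , t∈ = follow X r∈ (IsTree.connected isTree _ t)
        Z , Y⊑Z , ts∈ = visitAll Y (X⊑Y r∈) ts
    in Z , Y⊑Z ∘ X⊑Y , λ { (here refl) → Y⊑Z t∈ ; (there u∈) → ts∈ u∈ }

  spanned : ∃[ K ] Spans F K
  -- The traversal may begin anywhere: the 2-tree is still empty, so the clique condition is
  -- vacuous.
  spanned with add start (graph-vertex tree) (λ { (here refl) (here refl) → ε }) (λ ())
  ... | X , refl with visitAll X (here refl) (allFin _)
  ... | Y , _ , all∈ = twoTree Y
    , (λ v → let t , v∈ = coversVertex v in bag⇒∈ Y (all∈ (∈-allFin t)) v∈)
    , (λ uv → let t , u∈ , v∈ = coversEdge _ _ uv in bagClique Y (all∈ (∈-allFin t)) u∈ v∈)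

TreewidthAtMost2⇒UnderliesL₁⁺ : ∀ {F} → TreewidthAtMost 2 F → UnderliesL₁⁺ F
TreewidthAtMost2⇒UnderliesL₁⁺ (D , width≤2) = let K , spans = spanned D width≤2 in spans⇒UnderliesL₁⁺ K spans

theorem4p20 : (F : Graph) → UnderliesL₁⁺ F ⇔ TreewidthAtMost 2 F
theorem4p20 F = mk⇔ UnderliesL₁⁺⇒TreewidthAtMost2 TreewidthAtMost2⇒UnderliesL₁⁺
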